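{- Let $q$ be an integer and let $G$ be a graph on $m$ vertices with \[ q>|N^2(v)| + 2|N(v)| \] for all vertices $v$ of $G$. Then $G \square K_q$ is $\mathtt{VD}_{m}$.
   Context: Graphs are finite and simple. $N(v)$ is the set of vertices adjacent to $v$ in $G$, and $N^2(v)$ is the set of vertices at distance two from $v$ in $G$. For a vertex $v$ of a graph $H$, $N^\bullet_H(v)$ denotes the set consisting of $v$ and all vertices adjacent to $v$ in $H$; $H\setminus S$ is the graph obtained by deleting the vertices in $S$. $K_q$ is the complete graph on $q$ vertices. The cartesian product $G\square H$ is the graph with vertex set $V(G)\times V(H)$ and edge set \[ \{ (u,v)(u',v) \mid uu' \in E(G),\ v\in V(H) \} \cup \{ (u,v)(u,v') \mid u \in V(G),\ vv'\in E(H) \}. \] For non-negative integers $k$ the graph property $\mathtt{VD}_k$ is defined recursively (as the smallest family of properties closed under the following rules): any graph is $\mathtt{VD}_0$; a graph on $k$ vertices with no edges is $\mathtt{VD}_k$; if $k\ge 1$ and a graph $H$ has a vertex $v$ such that $H\setminus v$ is $\mathtt{VD}_k$ and $H\setminus N^\bullet_H(v)$ is $\mathtt{VD}_{k-1}$, then $H$ is $\mathtt{VD}_k$. -}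

module Defs where

open import Level using (0ℓ)
open import Data.Bool.Base using (Bool; true; false; T; not; if_then_else_)
open import Data.Bool.Properties using (T-irrelevant)
open import Data.Fin.Base using (Fin; zero; suc)
import Data.Fin.Properties as Fin
open import Data.Nat.Base using (ℕ; zero; suc; _*_; _<_)
open import Data.Nat.Properties using (allUpTo?)
open import Data.Product.Base using (∃; ∃-syntax; _×_; _,_)
open import Data.Product.Function.NonDependent.Propositional using (_×-↔_)
open import Data.Product.Properties using (Σ-≡,≡→≡)
open import Data.Sum.Base using (_⊎_; inj₁; inj₂)
open import Data.Vec.Base using (Vec; tabulate; count)
open import Function.Base using (_∘_; id)
open import Function.Bundles using (_↔_; mk↔ₛ′; Inverse)
open import Function.Properties.Inverse using (↔-refl; ↔-sym; ↔-trans; ↔⇒↣)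
import Relation.Binary.Definitions as Binary
open import Relation.Binary.Core using (Rel)
open import Relation.Binary.PropositionalEquality
  using (_≡_; _≢_; refl; sym; cong; subst; ≢-sym)
open import Relation.Nullary using (Dec; does; ¬_; ¬?; _×-dec_; _⊎-dec_)
open import Relation.Nullary.Decidable using (map′; via-injection)
open import Relation.Unary using (Pred; Decidable)

-- Adjacency is decidable so that neighbourhoods can be counted constructively.
record Graph : Set₁ where
  field
    V      : Set
    order  : ℕ
    finite : V ↔ Fin order
    Adj    : Rel V 0ℓ
    adj?   : Binary.Decidable Adj
    symm   : Binary.Symmetric Adj
    irrefl : Binary.Irreflexive _≡_ Adj

  _≟_ : Binary.DecidableEquality V
  _≟_ = via-injection (↔⇒↣ finite) Fin._≟_

  vertices : Vec V order
  vertices = tabulate (Inverse.from finite)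

  card : {S : Pred V 0ℓ} → Decidable S → ℕ
  card S? = count S? vertices

  ∃? : {S : Pred V 0ℓ} → Decidable S → Dec (∃ S)
  ∃? {S} S? = map′
    (λ (i , s) → Inverse.from finite i , s)
    (λ (v , s) → Inverse.to finite v
               , subst S (sym (Inverse.strictlyInverseʳ finite v)) s)
    (Fin.any? (S? ∘ Inverse.from finite))

  Walk : ℕ → Rel V 0ℓ
  Walk zero    u v = u ≡ v
  Walk (suc n) u v = ∃[ w ] Adj u w × Walk n w v

  walk? : ∀ n → Binary.Decidable (Walk n)
  walk? zero    u v = u ≟ v
  walk? (suc n) u v = ∃? λ w → adj? u w ×-dec walk? n w v

  -- A relation, not a function: vertices in different components have no
  -- distance.
  Distance : ℕ → Rel V 0ℓ
  Distance d u v = Walk d u v × (∀ {k} → k < d → ¬ Walk k u v)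

  distance? : ∀ d → Binary.Decidable (Distance d)
  distance? d u v = walk? d u v ×-dec allUpTo? (λ k → ¬? (walk? k u v)) d

  N : V → Pred V 0ℓ
  N v u = Adj v u

  N? : ∀ v → Decidable (N v)
  N? v = adj? v

  N² : V → Pred V 0ℓ
  N² v u = Distance 2 v u

  N²? : ∀ v → Decidable (N² v)
  N²? v = distance? 2 v

  N• : V → Pred V 0ℓ
  N• v u = u ≡ v ⊎ N v u

  N•? : ∀ v → Decidable (N• v)
  N•? v u = (u ≟ v) ⊎-dec N? v u

open Graph

private
  ∃-suc : ∀ {n k} {P : Pred (Fin (suc n)) 0ℓ} (b : Bool) → P zero ↔ T b →
          ∃ (P ∘ suc) ↔ Fin k → ∃ P ↔ Fin ((if b then suc else id) k)
  ∃-suc {k = k} {P} true e f = mk↔ₛ′ to from to∘from from∘to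
    where
    to : ∃ P → Fin (suc k)
    to (zero  , _) = zero
    to (suc i , p) = suc (Inverse.to f (i , p))

    from : Fin (suc k) → ∃ P
    from zero    = zero , Inverse.from e _
    from (suc j) = let (i , p) = Inverse.from f j in suc i , p

    to∘from : ∀ j → to (from j) ≡ j
    to∘from zero    = refl
    to∘from (suc j) = cong suc (Inverse.strictlyInverseˡ f j)

    from∘to : ∀ x → from (to x) ≡ x
    from∘to (zero  , p) = cong (zero ,_) (Inverse.strictlyInverseʳ e p)
    from∘to (suc i , p) =
      cong (λ (i , p) → suc i , p) (Inverse.strictlyInverseʳ f (i , p))
  ∃-suc {k = k} {P} false e f =
    mk↔ₛ′ to from (Inverse.strictlyInverseˡ f) from∘to
    where
    to : ∃ P → Fin k
    to (zero  , p) with () ← Inverse.to e p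
    to (suc i , p) = Inverse.to f (i , p)

    from : Fin k → ∃ P
    from j = let (i , p) = Inverse.from f j in suc i , p

    from∘to : ∀ x → from (to x) ≡ x
    from∘to (zero  , p) with () ← Inverse.to e p
    from∘to (suc i , p) =
      cong (λ (i , p) → suc i , p) (Inverse.strictlyInverseʳ f (i , p))

  ∃-Fin↔count : ∀ {A : Set} {S : Pred A 0ℓ} (S? : Decidable S) →
                ∀ {n} (f : Fin n → A) →
                (∃[ i ] T (does (S? (f i)))) ↔ Fin (count S? (tabulate f))
  ∃-Fin↔count S? {zero}  f = mk↔ₛ′ (λ ()) (λ ()) (λ ()) (λ ())
  ∃-Fin↔count S? {suc n} f =
    ∃-suc (does (S? (f zero))) ↔-refl (∃-Fin↔count S? (f ∘ suc))

  ∃-reindex : ∀ {A B : Set} {S : Pred A 0ℓ} (S? : Decidable S) (e : A ↔ B) →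
              (∃[ x ] T (does (S? x))) ↔ (∃[ y ] T (does (S? (Inverse.from e y))))
  ∃-reindex S? e = mk↔ₛ′
    (λ (x , p) → to x , subst (T ∘ does ∘ S?) (sym (strictlyInverseʳ x)) p)
    (λ (y , p) → from y , p)
    (λ (y , _) → Σ-≡,≡→≡ (strictlyInverseˡ y , T-irrelevant _ _))
    (λ (x , _) → Σ-≡,≡→≡ (strictlyInverseʳ x , T-irrelevant _ _))
    where open Inverse e

-- Non-membership in S is expressed by a proof-irrelevant type, so that each
-- remaining vertex occurs exactly once.
_∖_ : (H : Graph) {S : Pred (V H) 0ℓ} → Decidable S → Graph
H ∖ S? = record
  { V      = ∃[ v ] T (not (does (S? v)))
  ; order  = card H (¬? ∘ S?)
  ; finite = ↔-trans (∃-reindex (¬? ∘ S?) (finite H))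
                     (∃-Fin↔count (¬? ∘ S?) (Inverse.from (finite H)))
  ; Adj    = λ (u , _) (v , _) → Adj H u v
  ; adj?   = λ (u , _) (v , _) → adj? H u v
  ; symm   = symm H
  ; irrefl = λ { refl → irrefl H refl }
  }

infixl 6 _∖_
infixl 7 _□_

_□_ : Graph → Graph → Graph
G □ H = record
  { V      = V G × V H
  ; order  = order G * order H
  ; finite = ↔-trans (finite G ×-↔ finite H) (↔-sym Fin.*↔×)
  ; Adj    = λ (u , v) (u′ , v′) →
               (Adj G u u′ × v ≡ v′) ⊎ (u ≡ u′ × Adj H v v′)
  ; adj?   = λ (u , v) (u′ , v′) →
               (adj? G u u′ ×-dec _≟_ H v v′) ⊎-dec (_≟_ G u u′ ×-dec adj? H v v′)
  ; symm   = λ { (inj₁ (a , e)) → inj₁ (symm G a , sym e)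
               ; (inj₂ (e , a)) → inj₂ (sym e , symm H a) }
  ; irrefl = λ { refl (inj₁ (a , _)) → irrefl G refl a
               ; refl (inj₂ (_ , a)) → irrefl H refl a }
  }

K : ℕ → Graph
K q = record
  { V      = Fin q
  ; order  = q
  ; finite = ↔-refl
  ; Adj    = _≢_
  ; adj?   = λ u v → ¬? (u Fin.≟ v)
  ; symm   = ≢-sym
  ; irrefl = λ u≡v u≢v → u≢v u≡v
  }

data VD : ℕ → Graph → Set₁ where
  any      : ∀ {H} → VD 0 H
  edgeless : ∀ {k H} → order H ≡ k → (∀ u v → ¬ Adj H u v) → VD k H
  shed     : ∀ {k H} (v : V H) →
             VD (suc k) (H ∖ λ u → _≟_ H u v) →
             VD k (H ∖ N•? H v) →
             VD (suc k) H

module Submission where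

open import Defs
open import Data.Nat.Base using (ℕ; _+_; _*_; _>_)
open import Relation.Binary.PropositionalEquality using (_≡_)
open Graph using (V; order; card; N?; N²?)

open import Level using (0ℓ)
open import Data.Bool.Base using (T; not)
open import Data.Bool.Properties using (T-irrelevant)
open import Data.Fin.Base as Fin using (Fin)
open import Data.Fin.Permutation using (↔⇒≡)
import Data.Fin.Properties as Fin
open import Data.List.Base as List using ([]; _∷_; length)
open import Data.List.Membership.Propositional using (_∈_)
open import Data.List.Membership.Propositional.Properties using (∈-tabulate⁺)
open import Data.List.Relation.Unary.Any using (here; there)
open import Data.Nat.Base using (zero; suc; _≤_; _<_; z≤n; s≤s; s<s; s≤s⁻¹)
open import Data.Nat.Properties
  using (≤-refl; <-≤-trans; ≤-<-trans; ≤-antisym; m≤n⇒m≤1+n; +-suc; +-monoʳ-≤;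
         +-mono-≤; *-monoʳ-≤; *-suc; +-cancelˡ-<; suc-injective;
         +-commutativeSemigroup; module ≤-Reasoning)
open import Algebra.Properties.CommutativeSemigroup +-commutativeSemigroup
  using (x∙yz≈y∙xz)
open import Data.Product.Base using (∃; ∃-syntax; _×_; _,_; proj₁; proj₂)
open import Data.Product.Properties using (Σ-≡,≡→≡)
open import Data.Sum.Base using (_⊎_; inj₁; inj₂; map₂; fromInj₁)
open import Data.Unit.Base using (⊤; tt)
open import Data.Vec.Base using (Vec; []; _∷_; tabulate; count)
open import Function.Base using (_∘_; id)
open import Function.Bundles using (_↔_; mk↔ₛ′; Inverse)
open import Function.Properties.Inverse using (↔-sym; ↔-trans)
open import Relation.Binary.PropositionalEquality
  using (_≢_; refl; sym; trans; cong; subst)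
open import Relation.Nullary
  using (Dec; does; yes; no; ¬_; ¬?; _×-dec_; _⊎-dec_; contradiction)
open import Relation.Unary using (Pred; Decidable)

open Graph using (finite; Adj; adj?; symm; irrefl; N; N²; N•; N•?)

-- The independent sets of G □ K q are the partial proper colourings of G.  We
-- keep a list of available colours at every vertex, so that the current graph
-- is an induced subgraph of G □ K q.  Call a vertex active until its list has
-- been emptied or cut down to one isolated coloured vertex.  The invariant is
-- that every active u has more than |N²(u) ∩ A| + 2 |N(u) ∩ A| colours, A being
-- the set of active vertices.  Pick an active v and a colour c₀ of v.  Shed
-- (u , c₀) for all neighbours u of v, then (v , c) for all c ≠ c₀; this leaves
-- (v , c₀) isolated.  In the link of (u , c₀), u is no longer active, its
-- neighbours have lost at most c₀, and so have the other neighbours of v, which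
-- are at distance two from u.  In the link of (v , c), v is no longer active and
-- its neighbours have lost at most c₀ and c.  So the invariant is preserved
-- in the links and at the end of the shedding.

-- Comparing counts over finite enumerations.

module _ {A : Set} {P Q : Pred A 0ℓ} (P? : Decidable P) (Q? : Decidable Q) where

  count-mono : ∀ {n} (f : Fin n → A) → (∀ i → P (f i) → Q (f i)) →
               count P? (tabulate f) ≤ count Q? (tabulate f)
  count-mono {zero}  f P⊆Q = z≤n
  count-mono {suc n} f P⊆Q
    with P? (f Fin.zero) | Q? (f Fin.zero) | count-mono (f ∘ Fin.suc) (P⊆Q ∘ Fin.suc)
  ... | yes p | no ¬q | _  = contradiction (P⊆Q Fin.zero p) ¬q
  ... | yes _ | yes _ | le = s≤s le
  ... | no _  | yes _ | le = m≤n⇒m≤1+n le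
  ... | no _  | no _  | le = le

  count-strict : ∀ {n} (f : Fin n → A) → (∀ i → P (f i) → Q (f i)) →
                 ∀ i → ¬ P (f i) → Q (f i) →
                 count P? (tabulate f) < count Q? (tabulate f)
  count-strict f P⊆Q Fin.zero ¬p q with P? (f Fin.zero) | Q? (f Fin.zero)
  ... | yes p | _     = contradiction p ¬p
  ... | no _  | no ¬q = contradiction q ¬q
  ... | no _  | yes _ = s≤s (count-mono (f ∘ Fin.suc) (P⊆Q ∘ Fin.suc))
  count-strict f P⊆Q (Fin.suc i) ¬p q
    with P? (f Fin.zero) | Q? (f Fin.zero)
       | count-strict (f ∘ Fin.suc) (P⊆Q ∘ Fin.suc) i ¬p q
  ... | yes p | no ¬q | _  = contradiction (P⊆Q Fin.zero p) ¬q
  ... | yes _ | yes _ | lt = s<s lt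
  ... | no _  | yes _ | lt = m≤n⇒m≤1+n lt
  ... | no _  | no _  | lt = lt

  count-insert : ∀ {n} (f : Fin n → A) i → (∀ j → j ≢ i → P (f j) → Q (f j)) →
                 count P? (tabulate f) ≤ suc (count Q? (tabulate f))
  count-insert f Fin.zero P⊆Q
    with P? (f Fin.zero) | Q? (f Fin.zero)
       | count-mono (f ∘ Fin.suc) (λ j → P⊆Q (Fin.suc j) λ ())
  ... | yes _ | yes _ | le = s≤s (m≤n⇒m≤1+n le)
  ... | yes _ | no _  | le = s≤s le
  ... | no _  | yes _ | le = m≤n⇒m≤1+n (m≤n⇒m≤1+n le)
  ... | no _  | no _  | le = m≤n⇒m≤1+n le
  count-insert f (Fin.suc i) P⊆Q
    with P? (f Fin.zero) | Q? (f Fin.zero)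
       | count-insert (f ∘ Fin.suc) i (λ j j≢i → P⊆Q (Fin.suc j) (j≢i ∘ Fin.suc-injective))
  ... | yes p | no ¬q | _  = contradiction (P⊆Q Fin.zero (λ ()) p) ¬q
  ... | yes _ | yes _ | le = s≤s le
  ... | no _  | yes _ | le = m≤n⇒m≤1+n le
  ... | no _  | no _  | le = le

module _ {A : Set} {P : Pred A 0ℓ} (P? : Decidable P) where

  count-all : ∀ {n} (xs : Vec A n) → (∀ x → P x) → count P? xs ≡ n
  count-all []       all = refl
  count-all (x ∷ xs) all with P? x
  ... | yes _ = cong suc (count-all xs all)
  ... | no ¬p = contradiction (all x) ¬p

  count-positive : ∀ {n} (xs : Vec A n) → 0 < count P? xs → ∃ P
  count-positive (x ∷ xs) 0<c with P? x
  ... | yes p = x , p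
  ... | no _  = count-positive xs 0<c

-- Comparing cardinalities of vertex sets of a graph.

module _ (G : Graph) where

  open Graph G using (vertices; _≟_)
  open Inverse (finite G) using (from; to; strictlyInverseˡ; strictlyInverseʳ)

  module _ {P Q : Pred (V G) 0ℓ} (P? : Decidable P) (Q? : Decidable Q) where

    card-mono : (∀ v → P v → Q v) → card G P? ≤ card G Q?
    card-mono P⊆Q = count-mono P? Q? from (P⊆Q ∘ from)

    card-strict : (∀ v → P v → Q v) → ∀ v → ¬ P v → Q v → card G P? < card G Q?
    card-strict P⊆Q v ¬p q = count-strict P? Q? from (P⊆Q ∘ from) (to v)
      (¬p ∘ subst P (strictlyInverseʳ v)) (subst Q (sym (strictlyInverseʳ v)) q)

    card-insert : ∀ v → (∀ u → u ≢ v → P u → Q u) → card G P? ≤ suc (card G Q?)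
    card-insert v P⊆Q = count-insert P? Q? from (to v) λ j j≢ →
      P⊆Q (from j) λ e → j≢ (trans (sym (strictlyInverseˡ j)) (cong to e))

  -- Each entry of `xs` accounts for at most one vertex outside `Q`. Entries may repeat, which only
  -- weakens the bound.
  card-cover : {P Q : Pred (V G) 0ℓ} (P? : Decidable P) (Q? : Decidable Q) →
               ∀ xs → (∀ v → P v → Q v ⊎ v ∈ xs) →
               card G P? ≤ length xs + card G Q?
  card-cover P? Q? [] cover = card-mono P? Q? λ v p → fromInj₁ (λ ()) (cover v p)
  card-cover {P} {Q} P? Q? (x ∷ xs) cover = begin
    card G P?                        ≤⟨ card-cover P? Q∪x? xs shift ⟩
    length xs + card G Q∪x?          ≤⟨ +-monoʳ-≤ (length xs) (card-insert Q∪x? Q? x drop) ⟩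
    length xs + suc (card G Q?)      ≡⟨ +-suc (length xs) _ ⟩
    suc (length xs) + card G Q?      ∎
    where
    open ≤-Reasoning
    Q∪x? : Decidable (λ v → Q v ⊎ v ≡ x)
    Q∪x? v = Q? v ⊎-dec (v ≟ x)

    shift : ∀ v → P v → (Q v ⊎ v ≡ x) ⊎ v ∈ xs
    shift v p with cover v p
    ... | inj₁ q          = inj₁ (inj₁ q)
    ... | inj₂ (here v≡x) = inj₁ (inj₂ v≡x)
    ... | inj₂ (there v∈) = inj₂ v∈

    drop : ∀ v → v ≢ x → Q v ⊎ v ≡ x → Q v
    drop v v≢x (inj₁ q)   = q
    drop v v≢x (inj₂ v≡x) = contradiction v≡x v≢x

  order-cong : (H : Graph) → V G ↔ V H → order G ≡ order H
  order-cong H e = ↔⇒≡ (↔-trans (↔-sym (finite G)) (↔-trans e (finite H)))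

-- Induced subgraphs and shedding inside a fixed graph.

-- An isomorphism of H with the subgraph of B induced on S.
record _≅_[_] (H B : Graph) (S : Pred (V B) 0ℓ) : Set where
  field
    emb       : V H → V B
    injective : ∀ {u v} → emb u ≡ emb v → u ≡ v
    adj⇒      : ∀ {u v} → Adj H u v → Adj B (emb u) (emb v)
    adj⇐      : ∀ {u v} → Adj B (emb u) (emb v) → Adj H u v
    emb∈      : ∀ v → S (emb v)
    onto      : ∀ {x} → S x → ∃[ v ] emb v ≡ x

open _≅_[_]

T-not-does⇒¬ : {P : Set} (P? : Dec P) → T (not (does P?)) → ¬ P
T-not-does⇒¬ (no ¬p) _ = ¬p

¬⇒T-not-does : {P : Set} (P? : Dec P) → ¬ P → T (not (does P?))
¬⇒T-not-does (yes p) ¬p = ¬p p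
¬⇒T-not-does (no _)  _  = tt

∖-≡ : ∀ {H} {P : Pred (V H) 0ℓ} (P? : Decidable P) {u v : V (H ∖ P?)} →
      proj₁ u ≡ proj₁ v → u ≡ v
∖-≡ P? e = Σ-≡,≡→≡ (e , T-irrelevant _ _)

infixl 6 _−_

_−_ : {A : Set} → Pred A 0ℓ → Pred A 0ℓ → Pred A 0ℓ
(S − P) x = S x × ¬ P x

module _ {B : Graph} where

  ∖-≅ : ∀ {H S P} {Q : Pred (V H) 0ℓ} (Q? : Decidable Q) (e : H ≅ B [ S ]) →
        (∀ v → Q v → P (emb e v)) → (∀ v → P (emb e v) → Q v) →
        (H ∖ Q?) ≅ B [ S − P ]
  ∖-≅ {H} {S} {P} Q? e Q⇒P P⇒Q = record
    { emb       = emb e ∘ proj₁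
    ; injective = λ {u} {v} → ∖-≡ {H} Q? {u} {v} ∘ injective e
    ; adj⇒      = adj⇒ e
    ; adj⇐      = adj⇐ e
    ; emb∈      = λ (v , ¬q) → emb∈ e v , T-not-does⇒¬ (Q? v) ¬q ∘ P⇒Q v
    ; onto      = onto′
    }
    where
    onto′ : ∀ {x} → (S − P) x → ∃[ v ] emb e (proj₁ v) ≡ x
    onto′ (s , ¬p) with onto e s
    ... | v , refl = (v , ¬⇒T-not-does (Q? v) (¬p ∘ Q⇒P v)) , refl

-- Every deletion changes the vertex type, so the property is stated for all copies of the induced
-- subgraph. Successive deletions then only shrink `S` inside the fixed graph `B`.
VD[_] : (B : Graph) → ℕ → Pred (V B) 0ℓ → Set₁
VD[ B ] k S = ∀ {H} → H ≅ B [ S ] → VD k H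

module _ {B : Graph} {k : ℕ} where

  open Graph B using (_≟_)

  -- The embedding preserves and reflects adjacency, so the closed neighbourhood of the preimage of
  -- `x` is the trace of `N• B x`.
  shed-at : ∀ {S x} → S x → VD[ B ] (suc k) (S − (_≡ x)) →
            VD[ B ] k (S − N• B x) → VD[ B ] (suc k) S
  shed-at {S} Sx del link {H} e with onto e Sx
  ... | v , refl = shed v
    (del (∖-≅ (λ u → Graph._≟_ H u v) e (λ _ → cong (emb e)) (λ _ → injective e)))
    (link (∖-≅ (N•? H v) e
      (λ { _ (inj₁ refl) → inj₁ refl ; _ (inj₂ a) → inj₂ (adj⇒ e a) })
      (λ { _ (inj₁ eq) → inj₁ (injective e eq) ; _ (inj₂ a) → inj₂ (adj⇐ e a) })))

  record Between (S D S′ : Pred (V B) 0ℓ) : Set where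
    field
      mem? : Decidable S′
      sub  : ∀ {x} → S′ x → S x
      keep : ∀ {x} → S x → S′ x ⊎ D x

  open Between

  between-refl : ∀ {S D} → Decidable S → Between S D S
  between-refl S? = record { mem? = S? ; sub = id ; keep = inj₁ }

  between-delete : ∀ {S D S′ x} → D x → Between (S − (_≡ x)) D S′ → Between S D S′
  between-delete {S} {D} {S′} {x} Dx b = record
    { mem? = mem? b ; sub = proj₁ ∘ sub b ; keep = keep′ }
    where
    keep′ : ∀ {y} → S y → S′ y ⊎ D y
    keep′ {y} Sy with y ≟ x
    ... | yes refl = inj₂ Dx
    ... | no y≢x   = keep b (Sy , y≢x)

  -- Deleting a vertex keeps the index `suc k`, so vertices can be shed one after another, each at
  -- the price of its link. Links are demanded at every intermediate set, whatever the order of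
  -- shedding; entries outside `S` or `D` are skipped.
  shed-list : ∀ {D} (D? : Decidable D) ys {S} → Decidable S →
    (∀ {S′ x} → Between S D S′ → D x → S′ x → VD[ B ] k (S′ − N• B x)) →
    (∀ {S′} → Between S D S′ → (∀ {y} → y ∈ ys → D y → ¬ S′ y) → VD[ B ] (suc k) S′) →
    VD[ B ] (suc k) S
  shed-list D? [] S? link final = final (between-refl S?) λ ()
  shed-list {D} D? (y ∷ ys) {S} S? link final with S? y ×-dec D? y
  ... | yes (Sy , Dy) =
    shed-at Sy
      (shed-list D? ys (λ x → S? x ×-dec ¬? (x ≟ y)) (link ∘ between-delete Dy)
        λ b none → final (between-delete Dy b) λ
          { (here refl) _ S′y → proj₂ (sub b S′y) refl
          ; (there y∈)        → none y∈ })
      (link (between-refl S?) Dy Sy)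
  ... | no ¬SDy =
    shed-list D? ys S? link λ b none → final b λ
      { (here refl) Dy S′y → ¬SDy (sub b S′y , Dy)
      ; (there y∈)         → none y∈ }

  shed-all : ∀ {D} (D? : Decidable D) {S} → Decidable S →
    (∀ {S′ x} → Between S D S′ → D x → S′ x → VD[ B ] k (S′ − N• B x)) →
    (∀ {S′} → Between S D S′ → (∀ {y} → D y → ¬ S′ y) → VD[ B ] (suc k) S′) →
    VD[ B ] (suc k) S
  shed-all {D} D? S? link final =
    shed-list D? (List.tabulate from) S? link λ {S′} b none → final b λ {y} →
      none (subst (_∈ List.tabulate from) (strictlyInverseʳ y) (∈-tabulate⁺ (to y)))
    where open Inverse (finite B) using (from; to; strictlyInverseʳ)

-- Labellings of the vertices and the invariant on colours.

-- A vertex of G is fixed once exactly one of its colours remains and that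
-- coloured vertex is isolated; it is gone once none of its colours remain.
data Status : Set where
  gone fixed active : Status

gone? : Decidable (_≡ gone)
gone? gone   = yes refl
gone? fixed  = no λ ()
gone? active = no λ ()

active? : Decidable (_≡ active)
active? gone   = no λ ()
active? fixed  = no λ ()
active? active = yes refl

module _ (G : Graph) (q : ℕ) where

  open Graph G using (_≟_)

  private
    B : Graph
    B = G □ K q

  Labelling : Set
  Labelling = V G → Status

  update : Labelling → V G → Status → Labelling
  update t v s w with w ≟ v
  ... | yes _ = s
  ... | no _  = t w

  update-same : ∀ t v s → update t v s v ≡ s
  update-same t v s with v ≟ v
  ... | yes _  = refl
  ... | no v≢v = contradiction refl v≢v

  update-other : ∀ t {v} s {w} → w ≢ v → update t v s w ≡ t w
  update-other t {v} s {w} w≢v with w ≟ v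
  ... | yes w≡v = contradiction w≡v w≢v
  ... | no _    = refl

  -- The index of `VD` to be reached. Being the order of a graph, it can be compared with `order H`
  -- through a bijection.
  remaining : Labelling → ℕ
  remaining t = order (G ∖ (gone? ∘ t))

  activeOn? : (t : Labelling) {P : Pred (V G) 0ℓ} (P? : Decidable P) →
              Decidable (λ w → P w × t w ≡ active)
  activeOn? t P? w = P? w ×-dec active? (t w)

  demand : Labelling → V G → ℕ
  demand t v = card G (activeOn? t (N²? G v)) + 2 * card G (activeOn? t (N? G v))

  row : {S : Pred (V B) 0ℓ} → Decidable S → V G → ℕ
  row S? v = card (K q) (λ c → S? (v , c))

  -- The demand `d` is a parameter, so that the status can be analysed without disturbing the
  -- labelling behind `d`. In the `fixed` clause isolation also excludes a second colour, since
  -- colours at one vertex are pairwise adjacent.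
  Valid : {S : Pred (V B) 0ℓ} → Decidable S → ℕ → V G → Status → Set
  Valid {S} S? d v gone   = ∀ c → ¬ S (v , c)
  Valid {S} S? d v fixed  = ∃[ c ] S (v , c) × (∀ {z} → S z → ¬ Adj B (v , c) z)
  Valid {S} S? d v active = d < row S? v

  AllValid : {S : Pred (V B) 0ℓ} → Decidable S → Labelling → Set
  AllValid S? t = ∀ v → Valid S? (demand t v) v (t v)

  -- Fixed vertices have no neighbour in S: a deletion confined to touched
  -- vertices leaves them alone.
  Touched : Pred (V B) 0ℓ → Pred (V B) 0ℓ
  Touched S x = ∃[ z ] S z × Adj B x z

  -- The colours that `w` may lose are listed in `cs` and paid for by the drop in its demand.
  Loss : (t t′ : Labelling) (S S′ : Pred (V B) 0ℓ) → Pred (V G) 0ℓ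
  Loss t t′ S S′ w = ∃[ cs ] length cs + demand t′ w ≤ demand t w ×
    (∀ c → S (w , c) → S′ (w , c) ⊎ (c ∈ cs × Touched S (w , c)))

  -- The effect of deactivating one vertex.

  module _ {t : Labelling} {v : V G} (tv : t v ≡ active) where

    remaining-gone : remaining t ≡ suc (remaining (update t v gone))
    remaining-gone = ≤-antisym
      (card-insert G _ _ v λ u u≢v → subst (_≢ gone) (sym (update-other t gone u≢v)))
      (card-strict G _ _ other v (λ ¬g → ¬g (update-same t v gone)) (subst (_≢ gone) (sym tv) λ ()))
      where
      other : ∀ u → update t v gone u ≢ gone → t u ≢ gone
      other u ≢gone with u ≟ v
      ... | yes _ = contradiction refl ≢gone
      ... | no _  = ≢gone

    remaining-fixed : remaining (update t v fixed) ≡ remaining t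
    remaining-fixed = ≤-antisym (card-mono G _ _ down) (card-mono G _ _ up)
      where
      down : ∀ u → update t v fixed u ≢ gone → t u ≢ gone
      down u ≢gone with u ≟ v
      ... | yes refl = subst (_≢ gone) (sym tv) λ ()
      ... | no _     = ≢gone
      up : ∀ u → t u ≢ gone → update t v fixed u ≢ gone
      up u ≢gone with u ≟ v
      ... | yes _ = λ ()
      ... | no _  = ≢gone

    module _ {s : Status} (s≢active : s ≢ active) where

      private
        t′ : Labelling
        t′ = update t v s

        inactive : t′ v ≢ active
        inactive = subst (_≢ active) (sym (update-same t v s)) s≢active

      deactivate : ∀ u → t′ u ≡ active → t u ≡ active
      deactivate u e with u ≟ v
      ... | yes refl = tv
      ... | no _     = e

      active-decreases : card G (active? ∘ t′) < card G (active? ∘ t)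
      active-decreases = card-strict G _ _ deactivate v inactive tv

      module _ {P : Pred (V G) 0ℓ} (P? : Decidable P) where

        activeOn-mono : card G (activeOn? t′ P?) ≤ card G (activeOn? t P?)
        activeOn-mono = card-mono G _ _ λ u (p , e) → p , deactivate u e

        activeOn-strict : P v → card G (activeOn? t′ P?) < card G (activeOn? t P?)
        activeOn-strict p = card-strict G _ _ (λ u (p , e) → p , deactivate u e) v
          (inactive ∘ proj₂) (p , tv)

      demand-mono : ∀ u → demand t′ u ≤ demand t u
      demand-mono u =
        +-mono-≤ (activeOn-mono (N²? G u)) (*-monoʳ-≤ 2 (activeOn-mono (N? G u)))

      demand-far : ∀ {u} → N² G u v → 1 + demand t′ u ≤ demand t u
      demand-far {u} n² =
        +-mono-≤ (activeOn-strict (N²? G u) n²) (*-monoʳ-≤ 2 (activeOn-mono (N? G u)))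

      -- The vertex `v` leaves the active neighbours of `u`, which are counted with weight two.
      demand-near : ∀ {u} → N G u v → 2 + demand t′ u ≤ demand t u
      demand-near {u} n = begin
        2 + (x′ + 2 * y′)  ≡⟨ x∙yz≈y∙xz 2 x′ (2 * y′) ⟩
        x′ + (2 + 2 * y′)  ≡⟨ cong (x′ +_) (*-suc 2 y′) ⟨
        x′ + 2 * suc y′     ≤⟨ +-mono-≤ (activeOn-mono (N²? G u))
                                      (*-monoʳ-≤ 2 (activeOn-strict (N? G u) n)) ⟩
        demand t u         ∎
        where
        open ≤-Reasoning
        x′ y′ : ℕ
        x′ = card G (activeOn? t′ (N²? G u))
        y′ = card G (activeOn? t′ (N? G u))

      -- An active `w` loses at most `length cs` colours while its demand drops by at least as much,
      -- so the strict inequality survives. A fixed `w` keeps its colour because an isolated vertex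
      -- is never touched.
      valid-update : ∀ {S S′} (S? : Decidable S) (S′? : Decidable S′) →
        (∀ {x} → S′ x → S x) → (∀ w → w ≢ v → Loss t t′ S S′ w) →
        Valid S′? (demand t′ v) v s → AllValid S? t → AllValid S′? t′
      valid-update {S} {S′} S? S′? sub loss valid-v valid w with w ≟ v
      ... | yes refl = valid-v
      ... | no w≢v with t w | valid w | loss w w≢v
      ...   | gone   | absent         | _ = λ c → absent c ∘ sub
      ...   | fixed  | c , Sc , alone | _ , _ , keep with keep c Sc
      ...     | inj₁ S′c               = c , S′c , alone ∘ sub
      ...     | inj₂ (_ , _ , Sz , a)  = contradiction a (alone Sz)
      valid-update {S} {S′} S? S′? sub loss valid-v valid w
          | no w≢v | active | room | cs , le , keep =
        +-cancelˡ-< (length cs) _ _ (begin-strict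
          length cs + demand t′ w  ≤⟨ le ⟩
          demand t w               <⟨ room ⟩
          row S? w                 ≤⟨ card-cover (K q) _ _ cs covered ⟩
          length cs + row S′? w    ∎)
        where
        open ≤-Reasoning
        covered : ∀ c → S (w , c) → S′ (w , c) ⊎ c ∈ cs
        covered c Sc with keep c Sc
        ... | inj₁ S′c      = inj₁ S′c
        ... | inj₂ (c∈ , _) = inj₂ c∈

  -- Base case: no active vertex.

  none-active : ∀ {t S} (S? : Decidable S) → AllValid S? t →
                (∀ v → t v ≢ active) → VD[ B ] (remaining t) S
  none-active {t} {S} S? valid inactive {H} e =
    -- Every vertex that is not gone has exactly one colour left, so projecting to `G` is a
    -- bijection.
    edgeless (order-cong H (G ∖ (gone? ∘ t)) (mk↔ₛ′ to from to∘from from∘to)) no-edge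
    where
    present : ∀ {v c} → S (v , c) → t v ≢ gone
    present {v} {c} Sc tv = subst (Valid S? _ v) tv (valid v) c Sc

    colour : ∀ v → t v ≢ gone → ∃[ c ] S (v , c) × (∀ {z} → S z → ¬ Adj B (v , c) z)
    colour v ≢gone with t v | inactive v | valid v
    ... | gone   | _       | _ = contradiction refl ≢gone
    ... | fixed  | _       | f = f
    ... | active | ≢active | _ = contradiction refl ≢active

    -- The row of `x` contains an isolated vertex, and any other vertex of that row would be
    -- adjacent to it; hence `x` is that vertex.
    alone : ∀ {x y} → S x → S y → ¬ Adj B x y
    alone {v , c} {y} Sx Sy a with colour v (present Sx)
    ... | c′ , Sc′ , isolated with c′ Fin.≟ c
    ...   | yes refl = isolated Sy a
    ...   | no c′≢c  = isolated Sx (inj₂ (refl , c′≢c))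

    no-edge : ∀ x y → ¬ Adj H x y
    no-edge x y a = alone (emb∈ e x) (emb∈ e y) (adj⇒ e a)

    to : V H → V (G ∖ (gone? ∘ t))
    to x = proj₁ (emb e x) , ¬⇒T-not-does (gone? _) (present (emb∈ e x))

    vertex : ∀ v → t v ≢ gone → ∃[ x ] proj₁ (emb e x) ≡ v
    vertex v ≢gone = let (_ , Sc , _) = colour v ≢gone ; (x , eq) = onto e Sc
                     in x , cong proj₁ eq

    from : V (G ∖ (gone? ∘ t)) → V H
    from (v , p) = proj₁ (vertex v (T-not-does⇒¬ (gone? (t v)) p))

    to∘from : ∀ v → to (from v) ≡ v
    to∘from (v , p) = ∖-≡ {G} (gone? ∘ t) (proj₂ (vertex v (T-not-does⇒¬ (gone? (t v)) p)))

    same-row : ∀ {x y} → S x → S y → proj₁ x ≡ proj₁ y → x ≡ y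
    same-row {v , c} {.v , d} Sx Sy refl with c Fin.≟ d
    ... | yes refl = refl
    ... | no c≢d   = contradiction (inj₂ (refl , c≢d)) (alone Sx Sy)

    from∘to : ∀ x → from (to x) ≡ x
    from∘to x = injective e (same-row (emb∈ e _) (emb∈ e x) (cong proj₁ (to∘from (to x))))

  -- Induction on the number of active vertices.

  shed-active : ∀ n t {S} (S? : Decidable S) → card G (active? ∘ t) < n →
                AllValid S? t → VD[ B ] (remaining t) S
  shed-active (suc n) t {S} S? t<n valid with Graph.∃? G (active? ∘ t)
  ... | no none      = none-active S? valid λ v tv → none (v , tv)
  -- Since `v` is not gone, `remaining t` is `suc k`: the links must reach index `k`, the end of the
  -- shedding `suc k`.
  ... | yes (v , tv) = subst (λ k → VD[ B ] k S) (sym (remaining-gone tv))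
    -- `D₁` comes first: in its links `v` is still active and may have lost no colour other than
    -- `c₀`.
    (shed-all D₁? S? link₁ λ b₁ none₁ →
     shed-all D₂? (mem? b₁) (link₂ b₁) (final b₁ none₁))
    where
    open Between

    k : ℕ
    k = remaining (update t v gone)

    room : demand t v < row S? v
    room = subst (Valid S? _ v) tv (valid v)

    choice : ∃[ c ] S (v , c)
    choice = count-positive (λ c → S? (v , c)) (Graph.vertices (K q)) (≤-<-trans z≤n room)

    c₀ : Fin q
    c₀ = proj₁ choice

    Sc₀ : S (v , c₀)
    Sc₀ = proj₂ choice

    -- Together these form the neighbourhood of `(v , c₀)` in `B`, split along the two clauses of
    -- adjacency in the product.
    D₁ D₂ : Pred (V B) 0ℓ
    D₁ (u , c) = Adj G v u × c₀ ≡ c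
    D₂ (u , c) = v ≡ u × c₀ ≢ c

    D₁? : Decidable D₁
    D₁? (u , c) = adj? G v u ×-dec (c₀ Fin.≟ c)

    D₂? : Decidable D₂
    D₂? (u , c) = (v ≟ u) ×-dec ¬? (c₀ Fin.≟ c)

    touched₁ : ∀ {x} → D₁ x → Touched S x
    touched₁ (a , refl) = (v , c₀) , Sc₀ , inj₁ (symm G a , refl)

    recurse : ∀ {u s S′} (tu : t u ≡ active) (s≢active : s ≢ active) (S′? : Decidable S′) →
      (∀ {x} → S′ x → S x) → (∀ w → w ≢ u → Loss t (update t u s) S S′ w) →
      Valid S′? (demand (update t u s) u) u s →
      VD[ B ] (remaining (update t u s)) S′
    recurse {u} {s} tu s≢active S′? sub′ loss valid-u =
      -- Each recursive call deactivates a vertex, so the bound drops from `suc n` to `n`.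
      shed-active n (update t u s) S′? (<-≤-trans (active-decreases tu s≢active) (s≤s⁻¹ t<n))
        (valid-update tu s≢active S? S′? sub′ loss valid-u valid)

    -- The colours at `u` form a clique, so the link of one of them contains no other; hence `u`
    -- becomes gone.
    no-row : ∀ (S′ : Pred (V B) 0ℓ) u c c′ → ¬ (S′ − N• B (u , c)) (u , c′)
    no-row S′ u c c′ (_ , ¬n) with c Fin.≟ c′
    ... | yes refl = ¬n (inj₁ refl)
    ... | no c≢c′  = ¬n (inj₂ (inj₂ (refl , c≢c′)))

    minus? : ∀ {S′} → Decidable S′ → ∀ x → Decidable (S′ − N• B x)
    minus? S′? x y = S′? y ×-dec ¬? (N•? B x y)

    link₁ : ∀ {S′ x} → Between S D₁ S′ → D₁ x → S′ x → VD[ B ] k (S′ − N• B x)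
    link₁ {S′} {u , _} b (vu , refl) S′x =
      subst (λ k → VD[ B ] k (S′ − N• B (u , c₀)))
        -- Both `u` and `v` are active, so making either one gone lowers the count by one.
        (suc-injective (trans (sym (remaining-gone tu)) (remaining-gone tv)))
        (recurse tu (λ ()) (minus? (mem? b) (u , c₀)) (sub b ∘ proj₁) loss (no-row S′ u c₀))
      where
      -- A fixed `u` is impossible: its isolated vertex would be adjacent to `(v , c₀)` if it has
      -- colour `c₀`, and to `(u , c₀)` otherwise.
      tu : t u ≡ active
      tu with t u | valid u
      ... | gone   | absent = contradiction (sub b S′x) (absent c₀)
      ... | active | _ = refl
      ... | fixed  | c , Sc , alone with c Fin.≟ c₀
      ...   | yes refl = contradiction (inj₁ (symm G vu , refl)) (alone Sc₀)
      ...   | no c≢c₀  = contradiction (inj₂ (refl , c≢c₀)) (alone (sub b S′x))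

      kept : ∀ {w} → w ≢ u → ∀ c → S (w , c) →
        (S′ − N• B (u , c₀)) (w , c) ⊎
        ((Adj G u w ⊎ Adj G v w) × c ≡ c₀ × Touched S (w , c))
      kept w≢u c Sc with keep b Sc
      ... | inj₂ (vw , refl) = inj₂ (inj₂ vw , refl , touched₁ (vw , refl))
      ... | inj₁ S′c with N•? B (u , c₀) (_ , c)
      ...   | no ¬n = inj₁ (S′c , ¬n)
      ...   | yes (inj₁ refl) = contradiction refl w≢u
      ...   | yes (inj₂ (inj₁ (uw , refl))) =
        inj₂ (inj₁ uw , refl , (u , c₀) , sub b S′x , inj₁ (symm G uw , refl))
      ...   | yes (inj₂ (inj₂ (refl , _))) = contradiction refl w≢u

      loss : ∀ w → w ≢ u → Loss t (update t u gone) S (S′ − N• B (u , c₀)) w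
      loss w w≢u with adj? G u w | adj? G v w
      -- Only `c₀` can be lost; it is listed twice to match the drop of two. The vertex `v` falls
      -- under this case.
      ... | yes uw | _ = c₀ ∷ c₀ ∷ [] , demand-near tu (λ ()) (symm G uw) , λ c Sc →
        map₂ (λ (_ , eq , τ) → here eq , τ) (kept w≢u c Sc)
      -- Here `w` and `u` have the common neighbour `v`, so `u` is at distance two and its
      -- deactivation pays for `c₀`.
      ... | no ¬uw | yes vw = c₀ ∷ [] , demand-far tu (λ ()) far , λ c Sc →
        map₂ (λ (_ , eq , τ) → here eq , τ) (kept w≢u c Sc)
        where
        far : N² G w u
        far = (v , symm G vw , u , vu , refl) , λ
          { {0} _ w≡u → w≢u w≡u
          ; {1} _ (_ , wx , refl) → ¬uw (symm G wx)
          ; {suc (suc _)} (s≤s (s≤s ())) }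
      ... | no ¬uw | no ¬vw = [] , demand-mono tu (λ ()) w , untouched
        where
        untouched : ∀ c → S (w , c) → _
        untouched c Sc with kept w≢u c Sc
        ... | inj₁ kept′          = inj₁ kept′
        ... | inj₂ (inj₁ uw , _)  = contradiction uw ¬uw
        ... | inj₂ (inj₂ vw , _)  = contradiction vw ¬vw

    link₂ : ∀ {S₁} → Between S D₁ S₁ →
            ∀ {S′ x} → Between S₁ D₂ S′ → D₂ x → S′ x → VD[ B ] k (S′ − N• B x)
    link₂ b₁ {S′} {_ , c} b₂ (refl , _) S′x =
      recurse tv (λ ()) (minus? (mem? b₂) (v , c)) (sub b₁ ∘ sub b₂ ∘ proj₁) loss (no-row S′ v c)
      where
      kept : ∀ {w} → w ≢ v → ∀ d → S (w , d) →
        (S′ − N• B (v , c)) (w , d) ⊎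
        (Adj G v w × d ∈ c₀ ∷ c ∷ [] × Touched S (w , d))
      kept w≢v d Sd with keep b₁ Sd
      ... | inj₂ (vw , refl) = inj₂ (vw , here refl , touched₁ (vw , refl))
      ... | inj₁ S₁d with keep b₂ S₁d
      ...   | inj₂ (refl , _) = contradiction refl w≢v
      ...   | inj₁ S′d with N•? B (v , c) (_ , d)
      ...     | no ¬n = inj₁ (S′d , ¬n)
      ...     | yes (inj₁ refl) = contradiction refl w≢v
      ...     | yes (inj₂ (inj₁ (vw , refl))) =
        inj₂ (vw , there (here refl) , (v , c) , sub b₁ (sub b₂ S′x) , inj₁ (symm G vw , refl))
      ...     | yes (inj₂ (inj₂ (refl , _))) = contradiction refl w≢v

      loss : ∀ w → w ≢ v → Loss t (update t v gone) S (S′ − N• B (v , c)) w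
      loss w w≢v with adj? G v w
      -- Two distinct colours may go: `c₀` during the shedding of `D₁`, and `c` on passing to the
      -- link. This uses the full drop of two.
      ... | yes vw = c₀ ∷ c ∷ [] , demand-near tv (λ ()) (symm G vw) , λ d Sd →
        map₂ proj₂ (kept w≢v d Sd)
      ... | no ¬vw = [] , demand-mono tv (λ ()) w , λ d Sd →
        map₂ (λ (vw , _) → contradiction vw ¬vw) (kept w≢v d Sd)

    final : ∀ {S₁} → Between S D₁ S₁ → (∀ {y} → D₁ y → ¬ S₁ y) →
            ∀ {S₂} → Between S₁ D₂ S₂ → (∀ {y} → D₂ y → ¬ S₂ y) → VD[ B ] (suc k) S₂
    final b₁ none₁ {S₂} b₂ none₂ =
      subst (λ k → VD[ B ] k S₂) (trans (remaining-fixed tv) (remaining-gone tv))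
        (recurse tv (λ ()) (mem? b₂) (sub b₁ ∘ sub b₂) loss (c₀ , S₂c₀ , alone))
      where
      S₂c₀ : S₂ (v , c₀)
      S₂c₀ with keep b₁ Sc₀
      ... | inj₂ (vv , _) = contradiction vv (irrefl G refl)
      ... | inj₁ S₁c₀ with keep b₂ S₁c₀
      ...   | inj₂ (_ , c₀≢c₀) = contradiction refl c₀≢c₀
      ...   | inj₁ S₂c₀′ = S₂c₀′

      alone : ∀ {z} → S₂ z → ¬ Adj B (v , c₀) z
      alone S₂z (inj₁ d₁) = none₁ d₁ (sub b₂ S₂z)
      alone S₂z (inj₂ d₂) = none₂ d₂ S₂z

      kept : ∀ {w} → w ≢ v → ∀ c → S (w , c) → S₂ (w , c) ⊎ D₁ (w , c)
      kept w≢v c Sc with keep b₁ Sc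
      ... | inj₂ d₁ = inj₂ d₁
      ... | inj₁ S₁c with keep b₂ S₁c
      ...   | inj₂ (refl , _) = contradiction refl w≢v
      ...   | inj₁ S₂c = inj₁ S₂c

      loss : ∀ w → w ≢ v → Loss t (update t v fixed) S S₂ w
      loss w w≢v with adj? G v w
      ... | yes vw = c₀ ∷ c₀ ∷ [] , demand-near tv (λ ()) (symm G vw) , λ c Sc →
        map₂ (λ d₁ → here (sym (proj₂ d₁)) , touched₁ d₁) (kept w≢v c Sc)
      ... | no ¬vw = [] , demand-mono tv (λ ()) w , λ c Sc →
        map₂ (λ (vw , _) → contradiction vw ¬vw) (kept w≢v c Sc)

-- The full product, with every vertex active.

corollary2p14 : (q m : ℕ) (G : Graph) → order G ≡ m →
    (∀ (v : V G) → q > card G (N²? G v) + 2 * card G (N? G v)) →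
    VD m (G □ K q)
corollary2p14 q m G refl q> =
  subst (λ k → VD k (G □ K q)) all-remain
    -- The recursion bound starts at one more than the number of active vertices, whence `≤-refl`.
    (shed-active G q _ (λ _ → active) all? ≤-refl valid whole)
  where
  all? : Decidable (λ (_ : V (G □ K q)) → ⊤)
  all? _ = yes tt

  all-remain : remaining G q (λ _ → active) ≡ order G
  all-remain = count-all _ (Graph.vertices G) λ _ ()

  whole : (G □ K q) ≅ (G □ K q) [ (λ _ → ⊤) ]
  whole = record
    { emb = id ; injective = id ; adj⇒ = id ; adj⇐ = id
    ; emb∈ = λ _ → tt ; onto = λ {x} _ → x , refl }

  valid : AllValid G q all? (λ _ → active)
  valid v = begin-strict
    demand G q (λ _ → active) v                    ≤⟨ +-mono-≤ (card-mono G _ _ λ _ → proj₁)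
                                                        (*-monoʳ-≤ 2 (card-mono G _ _ λ _ → proj₁)) ⟩
    card G (N²? G v) + 2 * card G (N? G v)         <⟨ q> v ⟩
    q                                              ≡⟨ count-all _ (Graph.vertices (K q)) _ ⟨
    row G q all? v                                 ∎
    where open ≤-Reasoning
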